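{- Let $(\mathcal{A},\mathbf{m})$ be a cyclic sequencing problem with $n=2$ and let $a_k\in\mathcal{A}$ be the less abundant symbol. Consider the cycle returned by the Euclidean Sequencing Algorithm. If $m_k\mid N$, then all instances of symbol $a_k$ take the distance value $\Delta_j=N/m_k$. Otherwise, i.e. if $m_k\nmid N$, with $\ell_k:=\lfloor N/m_k\rfloor$ and $u_k:=\lceil N/m_k\rceil$, exactly $N_{\ell,k}=m_ku_k-N$ instances of $a_k$ take the distance value $\Delta_j=\ell_k$, while $N_{u,k}=N-m_k\ell_k$ instances of $a_k$ take the distance value $\Delta_j=u_k$.
   Context: Here $\mathbb{N}=\{1,2,\ldots\}$. A cyclic sequencing problem with $n=2$ is a couple $(\mathcal{A},\mathbf{m})$, where $\mathcal{A}=[a_1,a_2]$ is an alphabet of two distinct symbols and $\mathbf{m}=(m_1,m_2)\in\mathbb{N}^2$ is the vector of prescribed multiplicities. Put $N:=m_1+m_2$ and $\mathbb{Z}_N:=\mathbb{Z}/N\mathbb{Z}$. A cycle is a map $C:\mathbb{Z}_N\to\mathcal{A}$, with $C_j:=C([j]_N)$; the positions $j$ with $C_j=a_k$ are the instances of $a_k$. A word of length $N$ over $\mathcal{A}$ is identified with the cycle whose values $C_1,\ldots,C_N$ are its successive letters. For a cycle $C$ and a position $j$, $\Delta_j$ is the distance in steps from position $j$ to the next instance of the same symbol around the cycle, i.e. the least integer $d\ge 1$ with $C_{j+d}=C_j$ (indices modulo $N$); so $\Delta_j=N$ if the symbol appears only once. Euclidean Sequencing Algorithm (ESA). Words are multiplied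 by concatenation, and $W^q$ is the $q$-fold concatenation of $W$. Let $A_0$ be the symbol of higher multiplicity (the more abundant symbol) and $B_0$ the other one (the less abundant symbol); if $m_1=m_2$, either choice is allowed. Let $P_1$ and $D_1$ be the multiplicities of $A_0$ and $B_0$. For $i=1,2,\ldots$ set $Q_i:=\lfloor P_i/D_i\rfloor$, $R_i:=P_i-Q_iD_i$, $A_i:=A_{i-1}^{Q_i}B_{i-1}$, $B_i:=A_{i-1}$. If $R_i>0$, set $P_{i+1}:=D_i$, $D_{i+1}:=R_i$ and continue with $i+1$; if $R_i=0$, stop and return the cycle $C:=A_i^{D_i}$. -}

module Defs where

open import Data.Fin.Base using (Fin; zero; suc; toℕ; cast; opposite)
open import Data.List.Base using (List; _++_; [_]; length; lookup; concat; replicate; filter; allFin)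
open import Data.List.Properties using (length-++)
open import Data.Nat.Base
open import Data.Nat.DivMod using (_/_; _%_; _mod_; m%n<n; m≡m%n+[m/n]*n; [m+n]%n≡m%n; m<n⇒m%n≡m)
open import Data.Nat.Induction using (Acc; acc; <-wellFounded)
open import Data.Nat.Properties using (+-comm; *-identityʳ; _≤?_) renaming (_≟_ to _≟ⁿ_)
open import Data.Nat.Tactic.RingSolver using (solve-∀)
open import Data.Fin.Properties using (toℕ-fromℕ<; toℕ-injective; toℕ<n) renaming (_≟_ to _≟ᶠ_)
open import Data.Product.Base using (_×_; _,_; ∃; proj₁)
open import Function.Base using (_∘_)
open import Function.Bundles using (_↔_; Inverse)
open import Function.Construct.Symmetry using (↔-sym)
open import Function.Properties.Inverse using (↔⇒↣)
open import Level using (0ℓ)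
open import Relation.Binary.Definitions using (DecidableEquality)
open import Relation.Binary.PropositionalEquality
  using (_≡_; refl; sym; trans; cong; cong₂; module ≡-Reasoning)
open import Relation.Nullary.Decidable using (yes; no; via-injection; _×-dec_)
open import Relation.Nullary.Negation using (contradiction)
open import Relation.Unary using (Pred; Decidable)

⌈_/_⌉ : (n d : ℕ) .{{_ : NonZero d}} → ℕ
⌈ n / d ⌉ = (n + pred d) / d

IsLeast : Pred ℕ 0ℓ → Pred ℕ 0ℓ
IsLeast P d = P d × (∀ e → P e → d ≤ e)

least : {P : Pred ℕ 0ℓ} → Decidable P → ∀ n → P n → ∃ (IsLeast P)
least P? zero p = zero , p , λ _ _ → z≤n
least {P} P? (suc n) p with P? zero
... | yes p₀ = zero , p₀ , λ _ _ → z≤n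
... | no ¬p₀ with least (P? ∘ suc) n p
...   | d , pd , d-least = suc d , pd , bound
  where
  bound : ∀ e → P e → suc d ≤ e
  bound zero    pe = contradiction pe ¬p₀
  bound (suc e) pe = s≤s (d-least e pe)

-- The residues modulo N are represented by Fin N.
module _ {N : ℕ} .{{_ : NonZero N}} where

  infixl 6 _⊕_

  _⊕_ : Fin N → ℕ → Fin N
  j ⊕ d = (toℕ j + d) mod N

  ⊕-period : ∀ j → j ⊕ N ≡ j
  ⊕-period j = toℕ-injective
    (trans (toℕ-fromℕ< _) (trans ([m+n]%n≡m%n (toℕ j) N) (m<n⇒m%n≡m (toℕ<n j))))

  number : {P : Pred (Fin N) 0ℓ} → Decidable P → ℕ
  number P? = length (filter P? (allFin N))

  module _ {A : Set} where

    -- The letters of a word are C₁, …, C_N in this order, and C_N = C₀, so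
    -- that C_j is the letter with the zero-based index j − 1 modulo N.
    fromWord : (w : List A) → length w ≡ N → Fin N → A
    fromWord w |w|≡N j = lookup w (cast (sym |w|≡N) (j ⊕ pred N))

    Recurs : (Fin N → A) → Fin N → Pred ℕ 0ℓ
    Recurs C j d = 1 ≤ d × C (j ⊕ d) ≡ C j

    module _ (_≟_ : DecidableEquality A) where

      nextInstance : ∀ C j → ∃ (IsLeast (Recurs C j))
      nextInstance C j = least (λ d → 1 ≤? d ×-dec (C (j ⊕ d) ≟ C j))
                               N (>-nonZero⁻¹ N , cong C (⊕-period j))

      distance : (Fin N → A) → Fin N → ℕ
      distance C j = proj₁ (nextInstance C j)

infixr 8 _^^_

_^^_ : {A : Set} → List A → ℕ → List A
w ^^ q = concat (replicate q w)

length-^^ : {A : Set} (w : List A) (q : ℕ) → length (w ^^ q) ≡ q * length w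
length-^^ w zero    = refl
length-^^ w (suc q) = trans (length-++ w) (cong (length w +_) (length-^^ w q))

module _ {S : Set} where

  -- The iteration started at A_{i-1}, B_{i-1}, P_i, D_i, with
  -- Q_i = P / D and R_i = P % D.
  euclid : (A B : List S) (P D : ℕ) .{{_ : NonZero D}} → Acc _<_ D → List S
  euclid A B P D (acc rs) with P % D | m%n<n P D
  ... | zero  | _   = (A ^^ (P / D) ++ B) ^^ D
  ... | suc r | R<D = euclid (A ^^ (P / D) ++ B) A D (suc r) (rs R<D)

  length-euclid : ∀ A B P D .{{_ : NonZero D}} (ac : Acc _<_ D) →
    length (euclid A B P D ac) ≡ P * length A + D * length B
  length-euclid A B P D (acc rs) with P % D | m%n<n P D | m≡m%n+[m/n]*n P D
  ... | zero  | _   | P≡ = begin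
    length ((A ^^ Q ++ B) ^^ D)               ≡⟨ length-^^ (A ^^ Q ++ B) D ⟩
    D * length (A ^^ Q ++ B)                  ≡⟨ cong (D *_) (length-++ (A ^^ Q)) ⟩
    D * (length (A ^^ Q) + length B)          ≡⟨ cong (λ l → D * (l + length B)) (length-^^ A Q) ⟩
    D * (Q * length A + length B)             ≡⟨ rearrange D Q (length A) (length B) ⟩
    Q * D * length A + D * length B           ≡⟨ cong (λ p → p * length A + D * length B) P≡ ⟨
    P * length A + D * length B               ∎
    where
    open ≡-Reasoning
    Q = P / D
    rearrange : ∀ d q a b → d * (q * a + b) ≡ q * d * a + d * b
    rearrange = solve-∀
  ... | suc r | R<D | P≡ = begin
    length (euclid (A ^^ Q ++ B) A D R (rs R<D))            ≡⟨ length-euclid (A ^^ Q ++ B) A D R (rs R<D) ⟩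
    D * length (A ^^ Q ++ B) + R * length A                 ≡⟨ cong (λ l → D * l + R * length A) (length-++ (A ^^ Q)) ⟩
    D * (length (A ^^ Q) + length B) + R * length A         ≡⟨ cong (λ l → D * (l + length B) + R * length A) (length-^^ A Q) ⟩
    D * (Q * length A + length B) + R * length A            ≡⟨ rearrange D Q R (length A) (length B) ⟩
    (R + Q * D) * length A + D * length B                   ≡⟨ cong (λ p → p * length A + D * length B) P≡ ⟨
    P * length A + D * length B                             ∎
    where
    open ≡-Reasoning
    Q = P / D
    R = suc r
    rearrange : ∀ d q r a b → d * (q * a + b) + r * a ≡ (r + q * d) * a + d * b
    rearrange = solve-∀

record CyclicSequencingProblem : Set₁ where
  field
    Symbol    : Set
    alphabet  : Fin 2 ↔ Symbol
    m         : Fin 2 → ℕ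
    {{m-pos}} : ∀ {k} → NonZero (m k)

  a : Fin 2 → Symbol
  a = Inverse.to alphabet

  _≟_ : DecidableEquality Symbol
  _≟_ = via-injection (↔⇒↣ (↔-sym alphabet)) _≟ᶠ_

  N : ℕ
  N = m zero + m (suc zero)

  instance
    N-pos : NonZero N
    N-pos with m zero | m-pos {zero}
    ... | suc _ | _ = _

  Cycle : Set
  Cycle = Fin N → Symbol

  Δ : Cycle → Fin N → ℕ
  Δ = distance _≟_

  -- Both symbols qualify when the multiplicities are equal.
  LessAbundant : Pred (Fin 2) 0ℓ
  LessAbundant k = m k ≤ m (opposite k)

  -- B₀ = a b; when the multiplicities are equal, b is the choice of B₀.
  word : Fin 2 → List Symbol
  word b = euclid [ a (opposite b) ] [ a b ] (m (opposite b)) (m b) (<-wellFounded (m b))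

  length-word : ∀ b → length (word b) ≡ N
  length-word b = trans
    (length-euclid [ a (opposite b) ] [ a b ] (m (opposite b)) (m b) (<-wellFounded (m b)))
    (trans (cong₂ _+_ (*-identityʳ (m (opposite b))) (*-identityʳ (m b))) (total b))
    where
    total : ∀ b → m (opposite b) + m b ≡ N
    total zero       = +-comm (m (suc zero)) (m zero)
    total (suc zero) = refl

  ESA : ∀ b → LessAbundant b → Cycle
  ESA b _ = fromWord (word b) (length-word b)

  HasDistance : Cycle → Fin 2 → ℕ → Pred (Fin N) 0ℓ
  HasDistance C k d j = C j ≡ a k × Δ C j ≡ d

  hasDistance? : ∀ C k d → Decidable (HasDistance C k d)
  hasDistance? C k d j = (C j ≟ a k) ×-dec (Δ C j ≟ⁿ d)

  ℓ : Fin 2 → ℕ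
  ℓ k = N / m k

  u : Fin 2 → ℕ
  u k = ⌈ N / m k ⌉

{-# OPTIONS --safe #-}

-- Write a' for the other symbol, D = m_k, P = N − D, Q = ⌊P/D⌋ and R = P mod D.
-- After its second round the ESA only juxtaposes the blocks a'^Q a_k and
-- a'^Q a_k a', because a remaining A₀ = a' is always preceded by A₁ = a'^Q a_k.
-- Since every block starts with a'^Q a_k, also cyclically, the instance of a_k
-- in a block a'^Q a_k a'^e has distance Q + 1 + e. Counting letters through the
-- algorithm gives R blocks with e = 1 and D − R blocks with e = 0.
module Submission where

open import Defs
open import Data.Bool.Base using (true; false)
open import Data.Fin.Base using (Fin; zero; suc; toℕ; opposite)
open import Data.Fin.Properties using (toℕ-fromℕ<; toℕ-injective; toℕ<n; toℕ-cast; opposite-involutive)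
open import Data.Integer.Base using (+_; _-_)
open import Data.Integer.Properties using (⊖-≥; m-n≡m⊖n)
open import Data.List.Base
  using (List; []; _∷_; _++_; [_]; length; lookup; concatMap; concat; replicate; filter; map; allFin; tabulate)
open import Data.List.Membership.Propositional using (_∈_)
open import Data.List.Membership.Propositional.Properties using (∈-allFin; ∈-filter⁺; ∈-map⁺; ∈-map⁻)
open import Data.List.Properties
  using (++-assoc; ++-identityʳ; length-++; concatMap-++; filter-++; filter-accept;
         filter-reject; map-∘; map-replicate)
open import Data.List.Relation.Binary.Permutation.Propositional using (_↭_; ↭-refl; ↭-sym; ↭-trans; ↭-reflexive)
open import Data.List.Relation.Binary.Permutation.Propositional.Properties
  using (filter-↭; ↭-length; ∈-resp-↭; ∷↭∷ʳ)
open import Data.List.Relation.Unary.All as All using (All)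
open import Data.List.Relation.Unary.All.Properties using (replicate⁺)
open import Data.Nat.Base
open import Data.Nat.Divisibility using (_∣_; _∤_; ∣m+n∣m⇒∣n; ∣-refl; n∣m⇒m%n≡0; n∣m*n)
open import Data.Nat.DivMod
open import Data.Nat.Induction using (Acc; acc; <-wellFounded)
open import Data.Nat.Properties renaming (_≟_ to _≟ⁿ_)
open import Data.Nat.Tactic.RingSolver using (solve-∀)
open import Data.Product.Base using (_×_; _,_; ∃; proj₂)
open import Data.Sum.Base using (_⊎_; inj₁; inj₂)
open import Function.Base using (_∘_)
open import Function.Bundles using (Inverse)
open import Function.Definitions using (Injective)
open import Level using (0ℓ)
open import Relation.Binary.Definitions using (DecidableEquality)
open import Relation.Binary.PropositionalEquality
  using (_≡_; _≢_; refl; sym; trans; cong; cong₂; subst; module ≡-Reasoning)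
open import Relation.Nullary.Decidable using (yes; no; does; _×-dec_)
open import Relation.Nullary.Negation using (contradiction)
open import Relation.Unary using (Pred; Decidable)

-- Powers of words.

^^-+ : {A : Set} (w : List A) (m n : ℕ) → w ^^ (m + n) ≡ w ^^ m ++ w ^^ n
^^-+ w zero    n = refl
^^-+ w (suc m) n = trans (cong (w ++_) (^^-+ w m n)) (sym (++-assoc w (w ^^ m) (w ^^ n)))

^^-suc : {A : Set} (w : List A) (n : ℕ) → w ^^ suc n ≡ w ^^ n ++ w
^^-suc w n = begin
  w ^^ suc n       ≡⟨ cong (w ^^_) (+-comm 1 n) ⟩
  w ^^ (n + 1)     ≡⟨ ^^-+ w n 1 ⟩
  w ^^ n ++ w ++ [] ≡⟨ cong (w ^^ n ++_) (++-identityʳ w) ⟩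
  w ^^ n ++ w      ∎
  where open ≡-Reasoning

-- Single rounds of the algorithm.

module _ {S : Set} {A B : List S} (P D : ℕ) .{{_ : NonZero D}} where

  euclid-halts : (ac : Acc _<_ D) → P % D ≡ 0 → euclid A B P D ac ≡ (A ^^ (P / D) ++ B) ^^ D
  euclid-halts (acc rs) P%D≡0 with P % D | m%n<n P D | P%D≡0
  ... | zero | _ | refl = refl

  euclid-equal : (ac : Acc _<_ D) → P ≡ D → euclid A B P D ac ≡ (A ++ B) ^^ D
  euclid-equal ac refl = trans (euclid-halts ac (n%n≡0 D))
    (cong (λ w → (w ++ B) ^^ D) (trans (cong (A ^^_) (n/n≡1 D)) (++-identityʳ A)))

  -- The accessibility proof of the next round is left existential, since the lemmas applied to that
  -- round hold for every such proof.
  euclid-continues : ∀ {r} (ac : Acc _<_ D) → P % D ≡ suc r →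
    ∃ λ ac′ → euclid A B P D ac ≡ euclid (A ^^ (P / D) ++ B) A D (suc r) ac′
  euclid-continues (acc rs) P%D≡R with P % D | m%n<n P D | P%D≡R
  ... | suc r | R<D | refl = rs R<D , refl

-- Monoid homomorphisms of words and letter counts.

module _ {S T : Set} (F : List S → List T) (F-[] : F [] ≡ [])
         (F-++ : ∀ xs ys → F (xs ++ ys) ≡ F xs ++ F ys) where

  ^^-homo : ∀ w q → F (w ^^ q) ≡ F w ^^ q
  ^^-homo w zero    = F-[]
  ^^-homo w (suc q) = trans (F-++ w (w ^^ q)) (cong (F w ++_) (^^-homo w q))

  step-homo : ∀ A B q → F (A ^^ q ++ B) ≡ F A ^^ q ++ F B
  step-homo A B q = trans (F-++ (A ^^ q) B) (cong (_++ F B) (^^-homo A q))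

  -- The quotients depend on `P` and `D` alone, never on the words, so a homomorphism passes through
  -- each round. Filtering yields letter counts from this, and `concatMap h` yields substitution of
  -- blocks for letters.
  euclid-homo : ∀ A B P D .{{_ : NonZero D}} (ac : Acc _<_ D) →
    F (euclid A B P D ac) ≡ euclid (F A) (F B) P D ac
  euclid-homo A B P D (acc rs) with P % D | m%n<n P D
  ... | zero  | _   = trans (^^-homo (A ^^ (P / D) ++ B) D) (cong (_^^ D) (step-homo A B (P / D)))
  ... | suc r | R<D = trans (euclid-homo (A ^^ (P / D) ++ B) A D (suc r) (rs R<D))
    (cong (λ w → euclid w (F A) D (suc r) (rs R<D)) (step-homo A B (P / D)))

occurrences : ℕ → List ℕ → ℕ
occurrences c = length ∘ filter (_≟ⁿ c)

occurrences-++ : ∀ c xs ys → occurrences c (xs ++ ys) ≡ occurrences c xs + occurrences c ys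
occurrences-++ c xs ys = trans (cong length (filter-++ (_≟ⁿ c) xs ys)) (length-++ (filter (_≟ⁿ c) xs))

occurrences-^^ : ∀ c xs q → occurrences c (xs ^^ q) ≡ q * occurrences c xs
occurrences-^^ c xs q = trans (cong length (^^-homo (filter (_≟ⁿ c)) refl (filter-++ (_≟ⁿ c)) xs q))
  (length-^^ (filter (_≟ⁿ c) xs) q)

-- Filtering is a homomorphism, so this is the length formula for the algorithm run on the filtered
-- words.
occurrences-euclid : ∀ c A B P D .{{_ : NonZero D}} (ac : Acc _<_ D) →
  occurrences c (euclid A B P D ac) ≡ P * occurrences c A + D * occurrences c B
occurrences-euclid c A B P D ac = trans
  (cong length (euclid-homo (filter (_≟ⁿ c)) refl (filter-++ (_≟ⁿ c)) A B P D ac))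
  (length-euclid (filter (_≟ⁿ c) A) (filter (_≟ⁿ c) B) P D ac)

occurrences-map : ∀ (g : ℕ → ℕ) → Injective _≡_ _≡_ g → ∀ c xs →
  occurrences (g c) (map g xs) ≡ occurrences c xs
occurrences-map g g-inj c []       = refl
occurrences-map g g-inj c (x ∷ xs) with x ≟ⁿ c
... | yes x≡c = trans (cong length (filter-accept (_≟ⁿ g c) (cong g x≡c)))
  (trans (cong suc (occurrences-map g g-inj c xs)) (sym (cong length (filter-accept (_≟ⁿ c) x≡c))))
... | no x≢c  = trans (cong length (filter-reject (_≟ⁿ g c) (x≢c ∘ g-inj)))
  (trans (occurrences-map g g-inj c xs) (sym (cong length (filter-reject (_≟ⁿ c) x≢c))))

-- Decomposition of the returned word into two kinds of blocks.

-- Each B = X left over by the Euclidean step is absorbed by the preceding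
-- A = h 0, which turns it into h 1 = h 0 ++ X.
module _ {T : Set} (h : ℕ → List T) {X : List T} (h₁≡ : h 1 ≡ h 0 ++ X) where

  private
    absorb : ∀ p → concatMap h ([ 0 ] ^^ p ++ [ 1 ]) ≡ h 0 ^^ suc p ++ X
    absorb p = begin
      concatMap h ([ 0 ] ^^ p ++ [ 1 ]) ≡⟨ step-homo (concatMap h) refl (concatMap-++ h) [ 0 ] [ 1 ] p ⟩
      (h 0 ++ []) ^^ p ++ (h 1 ++ [])   ≡⟨ cong₂ (λ u v → u ^^ p ++ v) (++-identityʳ (h 0)) (trans (++-identityʳ (h 1)) h₁≡) ⟩
      h 0 ^^ p ++ (h 0 ++ X)            ≡⟨ ++-assoc (h 0 ^^ p) (h 0) X ⟨
      (h 0 ^^ p ++ h 0) ++ X            ≡⟨ cong (_++ X) (^^-suc (h 0) p) ⟨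
      h 0 ^^ suc p ++ X                 ∎
      where open ≡-Reasoning

    occurrences₀ : ∀ p → occurrences 0 ([ 0 ] ^^ p ++ [ 1 ]) ≡ p
    occurrences₀ p = trans (occurrences-++ 0 ([ 0 ] ^^ p) [ 1 ])
      (trans (+-identityʳ _) (trans (occurrences-^^ 0 [ 0 ] p) (*-identityʳ p)))

    occurrences₁ : ∀ p → occurrences 1 ([ 0 ] ^^ p ++ [ 1 ]) ≡ 1
    occurrences₁ p = trans (occurrences-++ 1 ([ 0 ] ^^ p) [ 1 ])
      (cong (_+ 1) (trans (occurrences-^^ 1 [ 0 ] p) (*-zeroʳ p)))

  euclid-blocks : ∀ D R .{{_ : NonZero R}} (ac : Acc _<_ R) → R < D → ∃ λ es →
    euclid (h 0) X D R ac ≡ concatMap h es × occurrences 0 es + R ≡ D × occurrences 1 es ≡ R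
  euclid-blocks D R ac R<D
    -- `R < D` makes the quotient positive, hence of the form `suc p`: there is always an `h 0` to
    -- absorb `X`.
    with D / R | D % R | m≥n⇒m/n>0 {D} {R} (<⇒≤ R<D) | m≡m%n+[m/n]*n D R
       | euclid-halts {A = h 0} {X} D R ac | (λ r → euclid-continues {A = h 0} {X} D R {r} ac)
  ... | suc p | zero | _ | D≡ | halts | _ =
    A ^^ R , trans (halts refl) (sym (trans (^^-homo (concatMap h) refl (concatMap-++ h) A R) (cong (_^^ R) (absorb p))))
    , trans (cong (_+ R) (trans (occurrences-^^ 0 A R) (cong (R *_) (occurrences₀ p)))) (trans (rearrange R p) (sym D≡))
    , trans (occurrences-^^ 1 A R) (trans (cong (R *_) (occurrences₁ p)) (*-identityʳ R))
    where
    A = [ 0 ] ^^ p ++ [ 1 ]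
    rearrange : ∀ R p → R * p + R ≡ 0 + suc p * R
    rearrange = solve-∀
  ... | suc p | suc r | _ | D≡ | _ | continues with continues r refl
  ...   | ac′ , eq =
    -- The witness is the rest of the algorithm run on exponents instead of words: `A` encodes
    -- `h 0 ^^ suc p ++ X` and `[ 0 ]` encodes `h 0`. Thus no induction over the rounds is needed
    -- here.
    euclid A [ 0 ] R (suc r) ac′
    , trans eq (sym (trans (euclid-homo (concatMap h) refl (concatMap-++ h) A [ 0 ] R (suc r) ac′)
        (cong₂ (λ u v → euclid u v R (suc r) ac′) (absorb p) (++-identityʳ (h 0)))))
    , trans (cong (_+ R) (trans (occurrences-euclid 0 A [ 0 ] R (suc r) ac′)
        (cong (λ o → R * o + suc r * 1) (occurrences₀ p)))) (trans (rearrange₀ R p r) (sym D≡))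
    , trans (occurrences-euclid 1 A [ 0 ] R (suc r) ac′)
        (trans (cong (λ o → R * o + suc r * 0) (occurrences₁ p)) (rearrange₁ R r))
    where
    A = [ 0 ] ^^ p ++ [ 1 ]
    rearrange₀ : ∀ R p r → R * p + suc r * 1 + R ≡ suc r + suc p * R
    rearrange₀ = solve-∀
    rearrange₁ : ∀ R r → R * 1 + suc r * 0 ≡ R
    rearrange₁ = solve-∀

-- Regrouping blocks into gaps between consecutive instances.

module _ {T : Set} (x y : T) where

  block : ℕ → ℕ → List T
  block Q e = [ x ] ^^ Q ++ y ∷ [ x ] ^^ e

  gap : ℕ → List T
  gap g = [ x ] ^^ g ++ [ y ]

  length-gap : ∀ g → length (gap g) ≡ suc g
  length-gap g = trans (length-++ ([ x ] ^^ g))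
    (trans (+-comm _ 1) (cong suc (trans (length-^^ [ x ] g) (*-identityʳ g))))

  -- The tail `[ x ] ^^ e` of a block merges with the `[ x ] ^^ Q` opening the next one into a
  -- single run of length `e + Q`. The appended `gap x y Q` plays the next block for the last one.
  blocks-gaps : ∀ Q es →
    concatMap (block Q) es ++ gap Q ≡ [ x ] ^^ Q ++ y ∷ concatMap gap (map (_+ Q) es)
  blocks-gaps Q []       = refl
  blocks-gaps Q (e ∷ es) = begin
    (block Q e ++ concatMap (block Q) es) ++ gap Q       ≡⟨ ++-assoc (block Q e) _ _ ⟩
    block Q e ++ (concatMap (block Q) es ++ gap Q)       ≡⟨ cong (block Q e ++_) (blocks-gaps Q es) ⟩
    block Q e ++ ([ x ] ^^ Q ++ y ∷ gaps)                ≡⟨ ++-assoc ([ x ] ^^ Q) _ _ ⟩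
    [ x ] ^^ Q ++ y ∷ [ x ] ^^ e ++ ([ x ] ^^ Q ++ y ∷ gaps)
      ≡⟨ cong (λ v → [ x ] ^^ Q ++ y ∷ v) (begin
        [ x ] ^^ e ++ ([ x ] ^^ Q ++ y ∷ gaps)   ≡⟨ ++-assoc ([ x ] ^^ e) _ _ ⟨
        ([ x ] ^^ e ++ [ x ] ^^ Q) ++ y ∷ gaps   ≡⟨ cong (_++ y ∷ gaps) (^^-+ [ x ] e Q) ⟨
        [ x ] ^^ (e + Q) ++ y ∷ gaps             ≡⟨ ++-assoc ([ x ] ^^ (e + Q)) [ y ] gaps ⟨
        gap (e + Q) ++ gaps                      ∎) ⟩
    [ x ] ^^ Q ++ y ∷ gap (e + Q) ++ gaps                ∎
    where
    open ≡-Reasoning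
    gaps = concatMap gap (map (_+ Q) es)

-- Residues and windows of consecutive positions.

module _ {N : ℕ} .{{_ : NonZero N}} where

  mod-cong : ∀ {m n} → m % N ≡ n % N → m mod N ≡ n mod N
  mod-cong eq = toℕ-injective (trans (toℕ-fromℕ< _) (trans eq (sym (toℕ-fromℕ< _))))

  mod-⊕ : ∀ n d → (n mod N) ⊕ d ≡ (n + d) mod N
  mod-⊕ n d = mod-cong (begin
    (toℕ (n mod N) + d) % N      ≡⟨ cong (λ t → (t + d) % N) (toℕ-fromℕ< (m%n<n n N)) ⟩
    (n % N + d) % N              ≡⟨ %-distribˡ-+ (n % N) d N ⟩
    (n % N % N + d % N) % N      ≡⟨ cong (λ t → (t + d % N) % N) (m%n%n≡m%n n N) ⟩
    (n % N + d % N) % N          ≡⟨ %-distribˡ-+ n d N ⟨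
    (n + d) % N                  ∎)
    where open ≡-Reasoning

  window : ℕ → ℕ → List (Fin N)
  window s zero    = []
  window s (suc n) = s mod N ∷ window (suc s) n

  window-∷ʳ : ∀ s n → window s (suc n) ≡ window s n ++ [ (s + n) mod N ]
  window-∷ʳ s zero    = cong (λ t → [ t mod N ]) (sym (+-identityʳ s))
  window-∷ʳ s (suc n) = cong (s mod N ∷_) (trans (window-∷ʳ (suc s) n)
    (cong (λ t → window (suc s) n ++ [ t mod N ]) (sym (+-suc s n))))

  tabulate-window : ∀ s n (f : Fin n → Fin N) → (∀ i → f i ≡ (s + toℕ i) mod N) → tabulate f ≡ window s n
  tabulate-window s zero    f f≡ = refl
  tabulate-window s (suc n) f f≡ = cong₂ _∷_
    (trans (f≡ zero) (cong (_mod N) (+-identityʳ s)))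
    (tabulate-window (suc s) n (f ∘ suc) (λ i → trans (f≡ (suc i)) (cong (_mod N) (+-suc s (toℕ i)))))

  -- Sliding a window of full length loses `s mod N` at the front and regains it at the back as
  -- `(s + N) mod N`.
  window-suc-↭ : ∀ s n → n ≡ N → window (suc s) n ↭ window s n
  window-suc-↭ s zero    eq = ↭-refl
  window-suc-↭ s (suc n) eq = ↭-sym (↭-trans (∷↭∷ʳ (s mod N) (window (suc s) n)) (↭-reflexive
    (trans (cong (λ j → window (suc s) n ++ [ j ]) (mod-cong
      (trans (sym ([m+n]%n≡m%n s N)) (cong (_% N) (trans (cong (λ t → s + t) (sym eq)) (+-suc s n))))))
      (sym (window-∷ʳ (suc s) n)))))

  -- This allows counts over all positions to start at any position, in particular at an instance of
  -- the symbol under study.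
  window-↭-allFin : ∀ s → window s N ↭ allFin N
  window-↭-allFin zero    = ↭-reflexive (sym (tabulate-window 0 N _
    (λ i → toℕ-injective (sym (trans (toℕ-fromℕ< _) (m<n⇒m%n≡m (toℕ<n i)))))))
  window-↭-allFin (suc s) = ↭-trans (window-suc-↭ s N refl) (window-↭-allFin s)

  -- Words read along a cycle.

  module _ {A : Set} where

    -- The starting position is a natural number and is reduced only when a letter is looked up, so
    -- a word may run past a full turn without case distinctions.
    data Reads (C : Fin N → A) : ℕ → List A → Set where
      []  : ∀ {s} → Reads C s []
      _∷_ : ∀ {s x xs} → C (s mod N) ≡ x → Reads C (suc s) xs → Reads C s (x ∷ xs)

    module _ {C : Fin N → A} where

      reads-lookup : ∀ s xs → (∀ i → C ((s + toℕ i) mod N) ≡ lookup xs i) → Reads C s xs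
      reads-lookup s []       eq = []
      reads-lookup s (x ∷ xs) eq =
        trans (cong (λ t → C (t mod N)) (sym (+-identityʳ s))) (eq zero) ∷
        reads-lookup (suc s) xs
          (λ i → trans (cong (λ t → C (t mod N)) (sym (+-suc s (toℕ i)))) (eq (suc i)))

      reads-+N : ∀ {s xs} → Reads C s xs → Reads C (s + N) xs
      reads-+N []       = []
      reads-+N {s} (e ∷ r) = trans (cong C (mod-cong ([m+n]%n≡m%n s N))) e ∷ reads-+N r

      reads-++⁺ : ∀ {s xs ys} → Reads C s xs → Reads C (s + length xs) ys → Reads C s (xs ++ ys)
      reads-++⁺ {s} {ys = ys} [] r′ = subst (λ t → Reads C t ys) (+-identityʳ s) r′
      reads-++⁺ {s} {ys = ys} (_∷_ {xs = xs} e r) r′ =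
        e ∷ reads-++⁺ r (subst (λ t → Reads C t ys) (+-suc s (length xs)) r′)

      reads-++⁻ˡ : ∀ {s} xs {ys} → Reads C s (xs ++ ys) → Reads C s xs
      reads-++⁻ˡ []       r       = []
      reads-++⁻ˡ (x ∷ xs) (e ∷ r) = e ∷ reads-++⁻ˡ xs r

      reads-++⁻ʳ : ∀ {s} xs {ys} → Reads C s (xs ++ ys) → Reads C (s + length xs) ys
      reads-++⁻ʳ {s} []       r       = subst (λ t → Reads C t _) (sym (+-identityʳ s)) r
      reads-++⁻ʳ {s} (x ∷ xs) {ys} (e ∷ r) =
        subst (λ t → Reads C t ys) (sym (+-suc s (length xs))) (reads-++⁻ʳ xs r)

    -- Reading starts at position 1, and the shift by `pred N` in `fromWord` undoes this offset
    -- modulo `N`.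
    fromWord-reads : ∀ w (|w|≡N : length w ≡ N) → Reads (fromWord w |w|≡N) 1 w
    fromWord-reads w |w|≡N = reads-lookup 1 w (λ i → cong (lookup w)
      (toℕ-injective (trans (toℕ-cast _ _) (position i))))
      where
      open ≡-Reasoning
      position : ∀ (i : Fin (length w)) → toℕ ((suc (toℕ i) mod N) ⊕ pred N) ≡ toℕ i
      position i = begin
        toℕ ((suc (toℕ i) mod N) ⊕ pred N) ≡⟨ cong toℕ (mod-⊕ (suc (toℕ i)) (pred N)) ⟩
        toℕ ((suc (toℕ i) + pred N) mod N) ≡⟨ toℕ-fromℕ< _ ⟩
        (suc (toℕ i) + pred N) % N         ≡⟨ cong (_% N) (+-suc (toℕ i) (pred N)) ⟨
        (toℕ i + suc (pred N)) % N         ≡⟨ cong (λ t → (toℕ i + t) % N) (suc-pred N) ⟩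
        (toℕ i + N) % N                    ≡⟨ [m+n]%n≡m%n (toℕ i) N ⟩
        toℕ i % N                          ≡⟨ m<n⇒m%n≡m (subst (toℕ i <_) |w|≡N (toℕ<n i)) ⟩
        toℕ i                              ∎

    -- Distances between consecutive instances.

    module _ (_≟_ : DecidableEquality A) where

      distance-unique : ∀ C j {d} → IsLeast (Recurs C j) d → distance _≟_ C j ≡ d
      distance-unique C j {d} (rec , d-least) with nextInstance _≟_ C j
      ... | d′ , rec′ , d′-least = ≤-antisym (d′-least d rec) (d-least d′ rec′)

      module _ {C : Fin N → A} {x y : A} (x≢y : x ≢ y) where

        first-instance : ∀ {s} g → Reads C s (gap x y g) →
          C ((s + g) mod N) ≡ y × (∀ e → C ((s + e) mod N) ≡ y → g ≤ e)
        first-instance {s} zero (eq ∷ _) =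
          trans (cong (λ t → C (t mod N)) (+-identityʳ s)) eq , λ _ _ → z≤n
        first-instance {s} (suc g) (eq ∷ r) with first-instance g r
        ... | hit , miss = trans (cong (λ t → C (t mod N)) (+-suc s g)) hit , bound
          where
          bound : ∀ e → C ((s + e) mod N) ≡ y → suc g ≤ e
          bound zero    hit′ = contradiction
            (trans (sym eq) (trans (cong (λ t → C (t mod N)) (sym (+-identityʳ s))) hit′)) x≢y
          bound (suc e) hit′ = s≤s (miss e (trans (cong (λ t → C (t mod N)) (sym (+-suc s e))) hit′))

        distance-gap : ∀ {s} g → Reads C s (y ∷ gap x y g) → distance _≟_ C (s mod N) ≡ suc g
        distance-gap {s} g (eq ∷ r) with first-instance g r
        ... | hit , miss = distance-unique C (s mod N) ((s≤s z≤n , trans (shift g) (trans hit (sym eq))) , bound)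
          where
          shift : ∀ e → C ((s mod N) ⊕ suc e) ≡ C ((suc s + e) mod N)
          shift e = cong C (trans (mod-⊕ s (suc e)) (cong (_mod N) (+-suc s e)))
          bound : ∀ e → Recurs C (s mod N) e → suc g ≤ e
          bound (suc e) (_ , rec) = s≤s (miss e (trans (sym (shift e)) (trans rec eq)))

        instances : List (Fin N) → List (Fin N)
        instances = filter (λ j → C j ≟ y)

        instances-skip : ∀ {s} g n → Reads C s ([ x ] ^^ g) →
          instances (window s (g + n)) ≡ instances (window (s + g) n)
        instances-skip {s} zero    n r = cong (λ t → instances (window t n)) (sym (+-identityʳ s))
        instances-skip {s} (suc g) n (eq ∷ r) = trans
          (filter-reject (λ j → C j ≟ y) (λ hit → x≢y (trans (sym eq) hit)))
          (trans (instances-skip g n r) (cong (λ t → instances (window t n)) (sym (+-suc s g))))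

        -- The word read is one letter longer than the window. Its last `y` is not counted; for
        -- nonempty `gs` it closes the gap after the last counted instance.
        distances-gaps : ∀ {s} gs → Reads C s (y ∷ concatMap (gap x y) gs) →
          map (distance _≟_ C) (instances (window s (length (concatMap (gap x y) gs)))) ≡ map suc gs
        distances-gaps {s} [] r = refl
        distances-gaps {s} (g ∷ gs) r@(eq ∷ r′) = begin
          map δ (instances (window s (length (gap x y g ++ gaps))))
            ≡⟨ cong (λ l → map δ (instances (window s l)))
                 (trans (length-++ (gap x y g)) (cong (_+ length gaps) (length-gap x y g))) ⟩
          map δ (instances (s mod N ∷ window (suc s) (g + length gaps)))
            ≡⟨ cong (map δ) (filter-accept (λ j → C j ≟ y) eq) ⟩
          δ (s mod N) ∷ map δ (instances (window (suc s) (g + length gaps)))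
            ≡⟨ cong₂ _∷_ (distance-gap g (reads-++⁻ˡ (y ∷ gap x y g) r))
                 (cong (map δ) (instances-skip g (length gaps)
                   (reads-++⁻ˡ ([ x ] ^^ g) (reads-++⁻ˡ (gap x y g) r′)))) ⟩
          suc g ∷ map δ (instances (window (suc s + g) (length gaps)))
            ≡⟨ cong (suc g ∷_) (distances-gaps gs rest) ⟩
          suc g ∷ map suc gs ∎
          where
          open ≡-Reasoning
          δ = distance _≟_ C
          gaps = concatMap (gap x y) gs
          rest : Reads C (suc s + g) (y ∷ gaps)
          rest = subst (λ t → Reads C (suc s + t) (y ∷ gaps))
            (trans (length-^^ [ x ] g) (*-identityʳ g))
            (reads-++⁻ʳ ([ x ] ^^ g) (subst (Reads C (suc s)) (++-assoc ([ x ] ^^ g) [ y ] gaps) r′))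

      -- Distances in a cycle composed of blocks.

      module _ {x y : A} (x≢y : x ≢ y) (w : List A) (|w|≡N : length w ≡ N) (Q : ℕ) where

        private
          C = fromWord w |w|≡N

        -- Position `suc Q` carries the first `y`, because reading starts at 1 and `w` begins with
        -- `gap x y Q`. Appending this prefix to `w` once more unrolls the wrap-around, so the full
        -- turn from `suc Q` is covered by the gaps of a linear word.
        distances-blocks : ∀ es → w ≡ concatMap (block x y Q) es →
          map (distance _≟_ C) (instances {C} x≢y (window (suc Q) N)) ≡ map (λ e → suc (e + Q)) es
        distances-blocks [] w≡ = contradiction (trans (sym |w|≡N) (cong length w≡)) (≢-nonZero⁻¹ N)
        distances-blocks es@(e ∷ es′) w≡ = begin
          map δ (instances {C} x≢y (window (suc Q) N))
            ≡⟨ cong (λ l → map δ (instances {C} x≢y (window (suc Q) l))) N≡ ⟩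
          map δ (instances {C} x≢y (window (suc Q) (length gaps)))
            ≡⟨ distances-gaps x≢y (map (_+ Q) es) reads-gaps ⟩
          map suc (map (_+ Q) es)
            ≡⟨ map-∘ es ⟨
          map (λ e → suc (e + Q)) es ∎
          where
          open ≡-Reasoning
          δ = distance _≟_ C
          gaps = concatMap (gap x y) (map (_+ Q) es)

          w-gap : w ++ gap x y Q ≡ [ x ] ^^ Q ++ y ∷ gaps
          w-gap = trans (cong (_++ gap x y Q) w≡) (blocks-gaps x y Q es)

          w-prefix : w ≡ gap x y Q ++ [ x ] ^^ e ++ concatMap (block x y Q) es′
          w-prefix = trans w≡ (trans (++-assoc ([ x ] ^^ Q) _ _) (sym (++-assoc ([ x ] ^^ Q) [ y ] _)))

          reads-w : Reads C 1 w
          reads-w = fromWord-reads w |w|≡N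

          -- Position `1 + N` is position 1 again, so the cycle repeats the prefix `gap x y Q` of
          -- `w` right after `w`.
          reads-w-gap : Reads C 1 (w ++ gap x y Q)
          reads-w-gap = reads-++⁺ reads-w (subst (λ l → Reads C (1 + l) (gap x y Q)) (sym |w|≡N)
            (reads-+N (reads-++⁻ˡ (gap x y Q) (subst (Reads C 1) w-prefix reads-w))))

          length-x^Q : length ([ x ] ^^ Q) ≡ Q
          length-x^Q = trans (length-^^ [ x ] Q) (*-identityʳ Q)

          reads-gaps : Reads C (suc Q) (y ∷ gaps)
          reads-gaps = subst (λ t → Reads C (suc t) (y ∷ gaps)) length-x^Q
            (reads-++⁻ʳ ([ x ] ^^ Q) (subst (Reads C 1) w-gap reads-w-gap))

          -- The gap appended at the end has as many letters as the omitted beginning, `Q` copies of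
          -- `x` and one `y`.
          N≡ : N ≡ length gaps
          N≡ = +-cancelʳ-≡ (suc Q) N (length gaps) (begin
            N + suc Q                              ≡⟨ cong₂ _+_ |w|≡N (length-gap x y Q) ⟨
            length w + length (gap x y Q)          ≡⟨ length-++ w ⟨
            length (w ++ gap x y Q)                ≡⟨ cong length w-gap ⟩
            length ([ x ] ^^ Q ++ y ∷ gaps)        ≡⟨ length-++ ([ x ] ^^ Q) ⟩
            length ([ x ] ^^ Q) + suc (length gaps) ≡⟨ cong (_+ suc (length gaps)) length-x^Q ⟩
            Q + suc (length gaps)                  ≡⟨ +-suc Q (length gaps) ⟩
            suc Q + length gaps                    ≡⟨ +-comm (suc Q) (length gaps) ⟩
            length gaps + suc Q                    ∎)

-- Auxiliary facts on counting and arithmetic.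

length-filter-×-dec : {A : Set} {P : Pred A 0ℓ} (P? : Decidable P) (f : A → ℕ) (d : ℕ) (xs : List A) →
  length (filter (λ j → P? j ×-dec (f j ≟ⁿ d)) xs) ≡ occurrences d (map f (filter P? xs))
length-filter-×-dec P? f d []       = refl
length-filter-×-dec P? f d (x ∷ xs) with does (P? x)
... | false = length-filter-×-dec P? f d xs
... | true with does (f x ≟ⁿ d)
...   | false = length-filter-×-dec P? f d xs
...   | true  = cong suc (length-filter-×-dec P? f d xs)

≡⊎≡opposite : ∀ (k b : Fin 2) → k ≡ b ⊎ k ≡ opposite b
≡⊎≡opposite zero       zero       = inj₁ refl
≡⊎≡opposite zero       (suc zero) = inj₂ refl
≡⊎≡opposite (suc zero) zero       = inj₂ refl
≡⊎≡opposite (suc zero) (suc zero) = inj₁ refl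

[r+qd]/d≡q : ∀ {r} q d .{{_ : NonZero d}} → r < d → (r + q * d) / d ≡ q
[r+qd]/d≡q {r} q d r<d = trans (+-distrib-/-∣ʳ r (n∣m*n q)) (cong₂ _+_ (m<n⇒m/n≡0 r<d) (m*n/n≡m q d))

-- The counts are first proved additively in the natural numbers; only this last passage uses
-- subtraction, over the integers, where nothing is truncated.
+-≡-minus : ∀ {a b c} → a + b ≡ c → + a ≡ + c - + b
+-≡-minus {a} {b} refl = sym (trans (m-n≡m⊖n (a + b) b) (trans (⊖-≥ (m≤n+m b a)) (cong +_ (m+n∸n≡m a b))))

-- Distances in the cycles of a sequencing problem.

module _ (problem : CyclicSequencingProblem) where
  open CyclicSequencingProblem problem

  a-injective : Injective _≡_ _≡_ a
  a-injective eq = trans (sym (Inverse.strictlyInverseʳ alphabet _))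
    (trans (cong (Inverse.from alphabet) eq) (Inverse.strictlyInverseʳ alphabet _))

  a-opposite : ∀ k → a (opposite k) ≢ a k
  a-opposite zero       eq with () ← a-injective eq
  a-opposite (suc zero) eq with () ← a-injective eq

  opposite+ : ∀ k → m (opposite k) + m k ≡ N
  opposite+ zero       = +-comm (m (suc zero)) (m zero)
  opposite+ (suc zero) = refl

  module _ (k : Fin 2) (w : List Symbol) (|w|≡N : length w ≡ N) (Q : ℕ) (es : List ℕ)
           (w≡ : w ≡ concatMap (block (a (opposite k)) (a k) Q) es) where

    private
      C : Cycle
      C = fromWord w |w|≡N

      distances = distances-blocks _≟_ (a-opposite k) w |w|≡N Q es w≡

    Δ-∈ : ∀ j → C j ≡ a k → Δ C j ∈ map (λ e → suc (e + Q)) es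
    Δ-∈ j hit = subst (Δ C j ∈_) distances
      (∈-map⁺ (Δ C) (∈-filter⁺ (λ j → C j ≟ a k) (∈-resp-↭ (↭-sym (window-↭-allFin (suc Q))) (∈-allFin j)) hit))

    -- The map from `e` to `suc (e + Q)` is injective, so counting distances amounts to counting
    -- block exponents.
    number-blocks : ∀ e → number (hasDistance? C k (suc (e + Q))) ≡ occurrences e es
    number-blocks e = begin
      length (filter (hasDistance? C k d) (allFin N))
        ≡⟨ ↭-length (filter-↭ (hasDistance? C k d) (window-↭-allFin (suc Q))) ⟨
      length (filter (hasDistance? C k d) (window (suc Q) N))
        ≡⟨ length-filter-×-dec (λ j → C j ≟ a k) (Δ C) d (window (suc Q) N) ⟩
      occurrences d (map (Δ C) (filter (λ j → C j ≟ a k) (window (suc Q) N)))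
        ≡⟨ cong (occurrences d) distances ⟩
      occurrences d (map (λ e → suc (e + Q)) es)
        ≡⟨ occurrences-map (λ e → suc (e + Q)) (λ eq → +-cancelʳ-≡ Q _ _ (suc-injective eq)) e es ⟩
      occurrences e es ∎
      where
      open ≡-Reasoning
      d = suc (e + Q)

  -- All blocks share one exponent, so the list of distances is constant. The symbol, `Q` and `e`
  -- stay free in order to serve both the divisible case and the case of equal multiplicities.
  Δ-uniform : ∀ k w (|w|≡N : length w ≡ N) Q e D →
    w ≡ block (a (opposite k)) (a k) Q e ^^ D →
    ∀ j → fromWord w |w|≡N j ≡ a k → Δ (fromWord w |w|≡N) j ≡ suc (e + Q)
  Δ-uniform k w |w|≡N Q e D w≡ j hit
    with e′ , e′∈ , Δ≡ ← ∈-map⁻ _ (Δ-∈ k w |w|≡N Q (replicate D e)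
           (trans w≡ (cong concat (sym (map-replicate _ D e)))) j hit)
    = trans Δ≡ (cong (λ e → suc (e + Q)) (All.lookup {P = _≡ e} (replicate⁺ D refl) e′∈))

  -- Quotients and distance counts when `a k` is taken as `B₀`.

  module _ (k : Fin 2) where

    private
      P = m (opposite k)
      D = m k
      Q = P / D
      x = a (opposite k)
      y = a k

    -- Passing from `P` to `N = P + D` raises the quotient by one and keeps the remainder. Hence the
    -- first remainder of the algorithm decides whether `D` divides `N`.
    N≡ : N ≡ P % D + suc Q * D
    N≡ = begin
      N                       ≡⟨ opposite+ k ⟨
      P + D                   ≡⟨ cong (_+ D) (m≡m%n+[m/n]*n P D) ⟩
      P % D + Q * D + D       ≡⟨ rearrange (P % D) Q D ⟩
      P % D + suc Q * D       ∎
      where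
      open ≡-Reasoning
      rearrange : ∀ r q d → r + q * d + d ≡ r + suc q * d
      rearrange = solve-∀

    ℓ≡ : ℓ k ≡ suc Q
    ℓ≡ = trans (cong (_/ D) N≡) ([r+qd]/d≡q (suc Q) D (m%n<n P D))

    -- One unit of the remainder `suc r` completes the `pred D` of the ceiling to a further `D`,
    -- which leaves the remainder `r`.
    u≡ : ∀ {r} → P % D ≡ suc r → u k ≡ suc (suc Q)
    u≡ {r} P%D≡ = trans (cong (_/ D) (begin
      N + pred D                        ≡⟨ cong (_+ pred D) N≡ ⟩
      P % D + suc Q * D + pred D        ≡⟨ cong (λ t → t + suc Q * D + pred D) P%D≡ ⟩
      suc r + suc Q * D + pred D        ≡⟨ rearrange r (suc Q * D) (pred D) ⟩
      r + (suc (pred D) + suc Q * D)    ≡⟨ cong (λ t → r + (t + suc Q * D)) (suc-pred D) ⟩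
      r + suc (suc Q) * D               ∎))
      ([r+qd]/d≡q (suc (suc Q)) D (<⇒≤ (subst (_< D) P%D≡ (m%n<n P D))))
      where
      open ≡-Reasoning
      rearrange : ∀ r t p → suc r + t + p ≡ r + (suc p + t)
      rearrange = solve-∀

    ∣N⇒%≡0 : D ∣ N → P % D ≡ 0
    ∣N⇒%≡0 D∣N = n∣m⇒m%n≡0 P D (∣m+n∣m⇒∣n (subst (D ∣_) (trans (sym (opposite+ k)) (+-comm P D)) D∣N) ∣-refl)

    %≡0⇒∣N : P % D ≡ 0 → D ∣ N
    %≡0⇒∣N P%D≡0 = subst (D ∣_) (sym (trans N≡ (cong (_+ suc Q * D) P%D≡0))) (n∣m*n (suc Q))

    -- The algorithm halts in its first round with `D` copies of `block x y Q 0`.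
    Δ-divisible : D ∣ N → ∀ j → fromWord (word k) (length-word k) j ≡ y →
      Δ (fromWord (word k) (length-word k)) j ≡ N / D
    Δ-divisible D∣N j hit = trans
      (Δ-uniform k (word k) (length-word k) Q 0 D (euclid-halts P D (<-wellFounded D) (∣N⇒%≡0 D∣N)) j hit)
      (sym ℓ≡)

    Blocks : ℕ → Set
    Blocks R = ∃ λ es →
      word k ≡ concatMap (block x y Q) es × occurrences 0 es + R ≡ D × occurrences 1 es ≡ R

    -- The first round turns the pair of words into `block x y Q 0` and `[ x ]`, and appending the
    -- latter to the former gives `block x y Q 1`.
    word-blocks : ∀ {r} → P % D ≡ suc r → Blocks (suc r)
    word-blocks {r} P%D≡
      with ac , eq ← euclid-continues {A = [ x ]} {[ y ]} P D (<-wellFounded D) P%D≡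
      with es , eq′ , counts ← euclid-blocks (block x y Q) {[ x ]} (sym (++-assoc ([ x ] ^^ Q) [ y ] [ x ])) D (suc r) ac
             (subst (_< D) P%D≡ (m%n<n P D))
      = es , trans eq eq′ , counts

    ∤N⇒%≡suc : D ∤ N → ∃ λ r → P % D ≡ suc r
    ∤N⇒%≡suc D∤N = pred (P % D) , sym (suc-pred (P % D) {{≢-nonZero (D∤N ∘ %≡0⇒∣N)}})

    -- With `R = suc r`, the `D - R` blocks of exponent 0 and the `R` blocks of exponent 1 are
    -- compared with `N = R + suc Q * D`.
    numbers : ∀ {r} → P % D ≡ suc r → Blocks (suc r) →
      number (hasDistance? (fromWord (word k) (length-word k)) k (ℓ k)) + N ≡ D * u k ×
      number (hasDistance? (fromWord (word k) (length-word k)) k (u k)) + D * ℓ k ≡ N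
    numbers {r} P%D≡ (es , w≡ , zeros , ones) = lower , upper
      where
      open ≡-Reasoning
      C = fromWord (word k) (length-word k)

      N≡′ : N ≡ suc r + suc Q * D
      N≡′ = trans N≡ (cong (_+ suc Q * D) P%D≡)

      lower : number (hasDistance? C k (ℓ k)) + N ≡ D * u k
      lower = begin
        number (hasDistance? C k (ℓ k)) + N
          ≡⟨ cong (λ d → number (hasDistance? C k d) + N) ℓ≡ ⟩
        number (hasDistance? C k (suc Q)) + N
          ≡⟨ cong₂ _+_ (number-blocks k (word k) (length-word k) Q es w≡ 0) N≡′ ⟩
        occurrences 0 es + (suc r + suc Q * D)   ≡⟨ +-assoc (occurrences 0 es) (suc r) _ ⟨
        occurrences 0 es + suc r + suc Q * D     ≡⟨ cong (_+ suc Q * D) zeros ⟩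
        suc (suc Q) * D                          ≡⟨ *-comm (suc (suc Q)) D ⟩
        D * suc (suc Q)                          ≡⟨ cong (D *_) (u≡ P%D≡) ⟨
        D * u k                                  ∎

      upper : number (hasDistance? C k (u k)) + D * ℓ k ≡ N
      upper = begin
        number (hasDistance? C k (u k)) + D * ℓ k
          ≡⟨ cong₂ (λ d l → number (hasDistance? C k d) + D * l) (u≡ P%D≡) ℓ≡ ⟩
        number (hasDistance? C k (suc (suc Q))) + D * suc Q
          ≡⟨ cong₂ _+_ (trans (number-blocks k (word k) (length-word k) Q es w≡ 1) ones) (*-comm D (suc Q)) ⟩
        suc r + suc Q * D   ≡⟨ N≡′ ⟨
        N                   ∎

  -- With equal multiplicities the more abundant symbol of the algorithm may be
  -- a_k; the cycle is then made of blocks a_k a', with Q = 0 and e = 1.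
  Δ-equal : ∀ b → m (opposite b) ≡ m b → ∀ j → fromWord (word b) (length-word b) j ≡ a (opposite b) →
    Δ (fromWord (word b) (length-word b)) j ≡ 2
  Δ-equal b m≡ = Δ-uniform (opposite b) (word b) (length-word b) 0 1 (m b)
    (trans (euclid-equal (m (opposite b)) (m b) (<-wellFounded (m b)) m≡)
      (cong (λ c → (a (opposite b) ∷ a c ∷ []) ^^ m b) (sym (opposite-involutive b))))

  -- Assembling the cases.

  DistanceCounts : Cycle → Fin 2 → Set
  DistanceCounts C k =
    (m k ∣ N → ∀ j → C j ≡ a k → Δ C j ≡ N / m k)
    ×
    (m k ∤ N →
      + number (hasDistance? C k (ℓ k)) ≡ + (m k * u k) - + N
      ×
      + number (hasDistance? C k (u k)) ≡ + N - + (m k * ℓ k))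

  counts-less : ∀ k → DistanceCounts (fromWord (word k) (length-word k)) k
  counts-less k = Δ-divisible k , λ D∤N →
    let R≡             = proj₂ (∤N⇒%≡suc k D∤N)
        lower , upper  = numbers k R≡ (word-blocks k R≡)
    in +-≡-minus lower , +-≡-minus upper

  -- Equal multiplicities give `N = 2 * D`, so the non-divisible alternative cannot occur.
  counts-equal : ∀ b → m (opposite b) ≡ m b → DistanceCounts (fromWord (word b) (length-word b)) (opposite b)
  counts-equal b m≡ =
    (λ _ j hit → trans (Δ-equal b m≡ j hit) (sym N/D≡2)) , λ D∤N → contradiction D∣N D∤N
    where
    D = m (opposite b)
    N≡2*D : N ≡ 2 * D
    N≡2*D = trans (sym (opposite+ b))
      (cong (λ t → D + t) (trans (sym m≡) (sym (+-identityʳ D))))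
    D∣N : D ∣ N
    D∣N = subst (D ∣_) (sym N≡2*D) (n∣m*n 2)
    N/D≡2 : N / D ≡ 2
    N/D≡2 = trans (cong (_/ D) N≡2*D) (m*n/n≡m 2 D)

  -- If `k` differs from the choice `b` of `B₀`, both symbols are less abundant, which forces equal
  -- multiplicities by antisymmetry.
  counts-ESA : ∀ b (b-less : LessAbundant b) k → LessAbundant k → k ≡ b ⊎ k ≡ opposite b →
    DistanceCounts (ESA b b-less) k
  counts-ESA b b-less .b            k-less (inj₁ refl) = counts-less b
  counts-ESA b b-less .(opposite b) k-less (inj₂ refl) = counts-equal b
    (≤-antisym (subst (λ c → m (opposite b) ≤ m c) (opposite-involutive b) k-less) b-less)

corollary3 : (problem : CyclicSequencingProblem) →
    let open CyclicSequencingProblem problem in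
    (b : Fin 2) (b-less : LessAbundant b) →
    (k : Fin 2) → LessAbundant k →
    let C = ESA b b-less in
    (m k ∣ N → ∀ j → C j ≡ a k → Δ C j ≡ N / m k)
    ×
    (m k ∤ N →
    + number (hasDistance? C k (ℓ k)) ≡ + (m k * u k) - + N
    ×
    + number (hasDistance? C k (u k)) ≡ + N - + (m k * ℓ k))
corollary3 problem b b-less k k-less =
  counts-ESA problem b b-less k k-less (≡⊎≡opposite k b)
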